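{- Let $U$ be a nonempty subset of $\mathbb{Q}[[t]]$. For all nonnegative integers $k$ and $\ell$, $$\alpha_{k+\ell}(U)\ge\alpha_k(U)+\alpha_\ell(U).$$
   Context: $\operatorname{ord}_t$ denotes the $t$-adic valuation on $\mathbb{Q}[[t]]$ ($\operatorname{ord}_t(0)=+\infty$). A $t$-ordering of $U$ is a sequence $(f_i(t))_{i\ge0}$ in $U$ with $f_0$ arbitrary and, for each $k\ge1$, $f_k$ minimizing $\sum_{j=0}^{k-1}\operatorname{ord}_t(f_k(t)-f_j(t))$ over $U$. The value $\alpha_k(U):=\sum_{j=0}^{k-1}\operatorname{ord}_t(f_k(t)-f_j(t))\in\mathbb{N}\cup\{+\infty\}$ is independent of the choice of $t$-ordering (the $t$-exponent sequence of $U$). -}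

module Defs where

open import Data.Nat using (ℕ; zero; suc; _≤_; _<_)
import Data.Nat as N
open import Data.Fin using (Fin; zero; suc)
open import Data.Maybe using (Maybe; just; nothing)
open import Data.Rational using (ℚ; 0ℚ; _-_)
open import Data.Product using (Σ; _×_)
open import Data.Unit using (⊤)
open import Data.Empty using (⊥)
open import Relation.Binary.PropositionalEquality using (_≡_; _≢_)

PS : Set
PS = ℕ → ℚ

_−ₚ_ : PS → PS → PS
(f −ₚ g) i = f i - g i

ℕ∞ : Set
ℕ∞ = Maybe ℕ

∞ : ℕ∞
∞ = nothing

_⊕_ : ℕ∞ → ℕ∞ → ℕ∞
just m ⊕ just n = just (m N.+ n)
_ ⊕ _ = nothing

_≤∞_ : ℕ∞ → ℕ∞ → Set
just m ≤∞ just n = m ≤ n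
_ ≤∞ nothing = ⊤
nothing ≤∞ just _ = ⊥

sum∞ : (k : ℕ) → (Fin k → ℕ∞) → ℕ∞
sum∞ zero v = just 0
sum∞ (suc k) v = v zero ⊕ sum∞ k (λ j → v (suc j))

-- ord_t f ≡ v (as a relation, since it is not computable constructively)
Ord : PS → ℕ∞ → Set
Ord f (just n) = ((i : ℕ) → i < n → f i ≡ 0ℚ) × (f n ≢ 0ℚ)
Ord f nothing = (i : ℕ) → f i ≡ 0ℚ

SumOrd : PS → (ℕ → PS) → ℕ → ℕ∞ → Set
SumOrd g f k s =
  Σ (Fin k → ℕ∞) λ v →
    ((j : Fin k) → Ord (g −ₚ f (Data.Fin.toℕ j)) (v j)) × (sum∞ k v ≡ s)

Subset : Set₁
Subset = PS → Set

IsTOrdering : Subset → (ℕ → PS) → Set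
IsTOrdering U f =
  ((i : ℕ) → U (f i)) ×
  ((k : ℕ) → 1 ≤ k → (g : PS) → U g → (a b : ℕ∞) →
     SumOrd (f k) f k a → SumOrd g f k b → a ≤∞ b)

IsAlpha : Subset → ℕ → ℕ∞ → Set
IsAlpha U k a = Σ (ℕ → PS) λ f → IsTOrdering U f × SumOrd (f k) f k a

Nonempty : Subset → Set
Nonempty U = Σ PS U

{-# OPTIONS --safe #-}
-- Let f be a t-ordering and n = k + ℓ.  Given points y₁,…,yₙ, match each y in turn
-- with the closest still unmatched point of a family of n + 1 points; by the
-- ultrametric inequality the point r left over satisfies
-- Σ ord(r − yⱼ) ≤ Σ ord(r − r′), r′ ranging over the other points of the family.
-- Applied to an arbitrary family and the points of f, this shows by induction that
-- f₀,…,fₙ₋₁ minimises the sum of the pairwise orders.  Applied to the family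
-- f₀,…,fₙ, it then yields r with Σ ord(r − yⱼ) ≤ αₙ.  Taking for the y's the first k
-- terms of one t-ordering and the first ℓ terms of another, the left side is at
-- least αₖ + α_ℓ.
module Submission where

open import Defs
open import Algebra.Bundles using (CommutativeMonoid)
import Algebra.Properties.CommutativeSemigroup as CommutativeSemigroupProperties
import Algebra.Properties.Group as GroupProperties
open import Data.Fin using (Fin; zero; suc; toℕ; fromℕ; fromℕ<; inject₁)
open import Data.Fin.Properties
  using (sequence; toℕ<n; toℕ-fromℕ; toℕ-fromℕ<; toℕ-inject₁; fromℕ<-cong)
open import Data.List using (List; []; _∷_; _++_; length)
open import Data.List.Properties using (length-++)
open import Data.List.Relation.Binary.Permutation.Propositional
  using (_↭_; refl; prep; swap; trans; ↭-refl; ↭-trans; ↭-prep; ↭-swap)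
open import Data.List.Relation.Binary.Permutation.Propositional.Properties
  using (↭-length; All-resp-↭)
open import Data.List.Relation.Unary.All as All using (All; []; _∷_)
open import Data.Maybe using (just; nothing)
open import Data.Nat using (ℕ; zero; suc; _+_; _≤_; _<_; z≤n; s≤s)
import Data.Nat.Properties as ℕ
open import Data.Nat.Induction using (<-rec)
open import Data.Product using (Σ; ∃; ∃₂; _×_; _,_; proj₁; proj₂)
open import Data.Rational using (0ℚ)
import Data.Rational.Properties as ℚ
open import Data.Sum using (_⊎_; inj₁; inj₂)
open import Data.Unit using (⊤; tt)
open import Effect.Monad using (RawMonad)
open import Level using (0ℓ)
open import Relation.Nullary using (¬_; Dec; yes; no; contradiction)
open import Relation.Nullary.Decidable using (decidable-stable)
open import Relation.Nullary.Negation using (¬¬-Monad; ¬¬-map)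
open import Relation.Binary.PropositionalEquality as ≡
  using (_≡_; _≢_; cong; cong₂; sym; subst)

-- Extended natural numbers

⊕-assoc : ∀ u v w → (u ⊕ v) ⊕ w ≡ u ⊕ (v ⊕ w)
⊕-assoc (just a) (just b) (just c) = cong just (ℕ.+-assoc a b c)
⊕-assoc (just a) (just b) nothing = ≡.refl
⊕-assoc (just a) nothing w = ≡.refl
⊕-assoc nothing v w = ≡.refl

⊕-comm : ∀ u v → u ⊕ v ≡ v ⊕ u
⊕-comm (just a) (just b) = cong just (ℕ.+-comm a b)
⊕-comm (just a) nothing = ≡.refl
⊕-comm nothing (just b) = ≡.refl
⊕-comm nothing nothing = ≡.refl

⊕-identityˡ : ∀ u → just 0 ⊕ u ≡ u
⊕-identityˡ (just a) = ≡.refl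
⊕-identityˡ nothing = ≡.refl

⊕-identityʳ : ∀ u → u ⊕ just 0 ≡ u
⊕-identityʳ u = ≡.trans (⊕-comm u (just 0)) (⊕-identityˡ u)

⊕-commutativeMonoid : CommutativeMonoid 0ℓ 0ℓ
⊕-commutativeMonoid = record
  { Carrier = ℕ∞ ; _≈_ = _≡_ ; _∙_ = _⊕_ ; ε = just 0
  ; isCommutativeMonoid = record
    { isMonoid = record
      { isSemigroup = record
        { isMagma = ≡.isMagma _⊕_
        ; assoc = ⊕-assoc }
      ; identity = ⊕-identityˡ , ⊕-identityʳ }
    ; comm = ⊕-comm } }

open CommutativeSemigroupProperties
  (CommutativeMonoid.commutativeSemigroup ⊕-commutativeMonoid)
  using (x∙yz≈y∙xz; interchange)

≤∞-nothing : ∀ u → u ≤∞ nothing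
≤∞-nothing (just _) = tt
≤∞-nothing nothing = tt

≤∞-refl : ∀ u → u ≤∞ u
≤∞-refl (just a) = ℕ.≤-refl
≤∞-refl nothing = tt

≤∞-reflexive : ∀ {u v} → u ≡ v → u ≤∞ v
≤∞-reflexive {u} ≡.refl = ≤∞-refl u

≤∞-trans : ∀ u v w → u ≤∞ v → v ≤∞ w → u ≤∞ w
≤∞-trans u v nothing _ _ = ≤∞-nothing u
≤∞-trans (just a) (just b) (just c) p q = ℕ.≤-trans p q

≤∞-antisym : ∀ u v → u ≤∞ v → v ≤∞ u → u ≡ v
≤∞-antisym (just a) (just b) p q = cong just (ℕ.≤-antisym p q)
≤∞-antisym nothing nothing _ _ = ≡.refl

≤∞-total : ∀ u v → u ≤∞ v ⊎ v ≤∞ u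
≤∞-total (just a) (just b) = ℕ.≤-total a b
≤∞-total u nothing = inj₁ (≤∞-nothing u)
≤∞-total nothing v = inj₂ (≤∞-nothing v)

_≤∞?_ : ∀ u v → Dec (u ≤∞ v)
just a ≤∞? just b = a ℕ.≤? b
just a ≤∞? nothing = yes tt
nothing ≤∞? just b = no λ ()
nothing ≤∞? nothing = yes tt

⊕-mono : ∀ u u′ v v′ → u ≤∞ u′ → v ≤∞ v′ → (u ⊕ v) ≤∞ (u′ ⊕ v′)
⊕-mono (just a) (just b) (just c) (just d) p q = ℕ.+-mono-≤ p q
⊕-mono u (just b) v nothing p q = ≤∞-nothing (u ⊕ v)
⊕-mono u nothing v v′ p q = ≤∞-nothing (u ⊕ v)

-- With `v` and `w` finite, the equation forces `u` and `w′` to be finite, so the cancellation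
-- happens in `ℕ`. With `w` infinite, the equation would say nothing about `u`.
⊕-cancel : ∀ u v w w′ → w ≢ nothing → w ≤∞ w′ → u ⊕ w′ ≡ v ⊕ w → u ≤∞ v
⊕-cancel u nothing w w′ _ _ _ = ≤∞-nothing u
⊕-cancel u (just b) nothing w′ w≢∞ _ _ = contradiction ≡.refl w≢∞
⊕-cancel (just a) (just b) (just c) (just c′) _ c≤c′ eq =
  ℕ.+-cancelʳ-≤ c a b
    (ℕ.≤-trans (ℕ.+-monoʳ-≤ a c≤c′) (ℕ.≤-reflexive (just-inj eq)))
  where
  just-inj : ∀ {m n : ℕ} → _≡_ {A = ℕ∞} (just m) (just n) → m ≡ n
  just-inj ≡.refl = ≡.refl

⊕≡∞ : ∀ u v → u ⊕ v ≡ nothing → u ≡ nothing ⊎ v ≡ nothing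
⊕≡∞ nothing v _ = inj₁ ≡.refl
⊕≡∞ (just a) nothing _ = inj₂ ≡.refl

∞≤⇒≡∞ : ∀ {u v} → u ≡ nothing → u ≤∞ v → v ≡ nothing
∞≤⇒≡∞ {v = nothing} _ _ = ≡.refl
∞≤⇒≡∞ {v = just _} ≡.refl ()

sum∞-cong : ∀ k {v w : Fin k → ℕ∞} → (∀ j → v j ≡ w j) → sum∞ k v ≡ sum∞ k w
sum∞-cong zero eq = ≡.refl
sum∞-cong (suc k) eq = cong₂ _⊕_ (eq zero) (sum∞-cong k (λ j → eq (suc j)))

-- `sum∞` unfolds from index 0, whereas the lists of terms used below start with the latest one.
sum∞-last : ∀ k (v : Fin (suc k) → ℕ∞) →
  sum∞ (suc k) v ≡ v (fromℕ k) ⊕ sum∞ k (λ j → v (inject₁ j))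
sum∞-last zero v = ≡.refl
sum∞-last (suc k) v =
  ≡.trans (cong (v zero ⊕_) (sum∞-last k (λ j → v (suc j))))
          (x∙yz≈y∙xz (v zero) (v (fromℕ (suc k))) _)

-- Ultrametric spaces, with d playing the role of the valuation of a difference

module Ultrametric {X : Set} (d : X → X → ℕ∞)
  (d-sym : ∀ x y → d x y ≡ d y x)
  -- Larger `d` means closer: this is d x z ≥ min (d x y) (d z y) in the case where the minimum is
  -- `d x y`.
  (d-ultra : ∀ x y z → d x y ≤∞ d z y → d x y ≤∞ d x z) where

  σ : X → List X → ℕ∞
  σ x [] = just 0
  σ x (y ∷ ys) = d x y ⊕ σ x ys

  -- For power series, this is the t-adic order of the Vandermonde product of the points.
  disc : List X → ℕ∞
  disc [] = just 0
  disc (x ∷ xs) = σ x xs ⊕ disc xs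

  σ-++ : ∀ x ys zs → σ x (ys ++ zs) ≡ σ x ys ⊕ σ x zs
  σ-++ x [] zs = sym (⊕-identityˡ _)
  σ-++ x (y ∷ ys) zs =
    ≡.trans (cong (d x y ⊕_) (σ-++ x ys zs)) (sym (⊕-assoc (d x y) (σ x ys) (σ x zs)))

  σ-↭ : ∀ x {ys zs} → ys ↭ zs → σ x ys ≡ σ x zs
  σ-↭ x refl = ≡.refl
  σ-↭ x (prep y p) = cong (d x y ⊕_) (σ-↭ x p)
  σ-↭ x (swap y z p) =
    ≡.trans (cong (λ s → d x y ⊕ (d x z ⊕ s)) (σ-↭ x p)) (x∙yz≈y∙xz (d x y) (d x z) _)
  σ-↭ x (trans p q) = ≡.trans (σ-↭ x p) (σ-↭ x q)

  disc-↭ : ∀ {xs ys} → xs ↭ ys → disc xs ≡ disc ys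
  disc-↭ refl = ≡.refl
  disc-↭ (prep x p) = cong₂ _⊕_ (σ-↭ x p) (disc-↭ p)
  disc-↭ {x ∷ y ∷ xs} {y ∷ x ∷ ys} (swap x y p) = begin
    (d x y ⊕ σ x xs) ⊕ (σ y xs ⊕ disc xs) ≡⟨ interchange (d x y) (σ x xs) (σ y xs) (disc xs) ⟩
    (d x y ⊕ σ y xs) ⊕ (σ x xs ⊕ disc xs)
      ≡⟨ cong₂ _⊕_ (cong₂ _⊕_ (d-sym x y) (σ-↭ y p)) (cong₂ _⊕_ (σ-↭ x p) (disc-↭ p)) ⟩
    (d y x ⊕ σ y ys) ⊕ (σ x ys ⊕ disc ys) ∎
    where open ≡.≡-Reasoning
  disc-↭ (trans p q) = ≡.trans (disc-↭ p) (disc-↭ q)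

  closest : ∀ y x xs →
    ∃₂ λ m rest → (x ∷ xs) ↭ (m ∷ rest) × All (λ z → d z y ≤∞ d m y) rest
  closest y x [] = x , [] , ↭-refl , []
  closest y x (x′ ∷ xs) with closest y x′ xs
  ... | m , rest , p , m-closest with ≤∞-total (d x y) (d m y)
  ... | inj₁ x≤m =
    m , x ∷ rest , ↭-trans (↭-prep x p) (↭-swap x m ↭-refl) , x≤m ∷ m-closest
  ... | inj₂ m≤x =
    x , m ∷ rest , ↭-prep x p ,
    m≤x ∷ All.map (λ z≤m → ≤∞-trans _ (d m y) _ z≤m m≤x) m-closest

  -- `rest` lists the matches of `ys` in order. When `y` takes `m`, the final `r` is still
  -- available, so `d r y ≤∞ d m y`, and `d-ultra` gives `d r y ≤∞ d r m`; these inequalities add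
  -- up.
  exchange : ∀ ys xs → length xs ≡ suc (length ys) →
    ∃₂ λ r rest → xs ↭ (r ∷ rest) × σ r ys ≤∞ σ r rest
  exchange [] (x ∷ []) _ = x , [] , ↭-refl , z≤n
  exchange (y ∷ ys) (x ∷ xs) len with closest y x xs
  ... | m , xs′ , p , m-closest
    with exchange ys xs′ (ℕ.suc-injective (≡.trans (sym (↭-length p)) len))
  ... | r , rest , q , r≤ =
    r , m ∷ rest , ↭-trans p (↭-trans (↭-prep m q) (↭-swap m r ↭-refl)) ,
    ⊕-mono (d r y) (d r m) (σ r ys) (σ r rest)
      (d-ultra r y m (All.head (All-resp-↭ q m-closest))) r≤

  -- The terms of a t-ordering, latest first.
  Greedy : List X → Set
  Greedy [] = ⊤
  Greedy (f ∷ fs) = (∀ x → σ f fs ≤∞ σ x fs) × Greedy fs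

  -- Exchanging `xs` against the earlier terms `fs` gives σ f fs ≤ σ r fs ≤ σ r rest; induction
  -- compares `fs` with `rest`.
  greedy-disc-min : ∀ fs → Greedy fs → ∀ xs → length xs ≡ length fs → disc fs ≤∞ disc xs
  greedy-disc-min [] _ [] _ = z≤n
  greedy-disc-min (f ∷ fs) (f-min , fs-greedy) xs len with exchange fs xs len
  ... | r , rest , p , r≤ =
    ≤∞-trans _ (disc (r ∷ rest)) _
      (⊕-mono (σ f fs) (σ r rest) (disc fs) (disc rest)
        (≤∞-trans _ (σ r fs) _ (f-min r) r≤)
        (greedy-disc-min fs fs-greedy rest
          (ℕ.suc-injective (≡.trans (sym (↭-length p)) len))))
      (≤∞-reflexive (sym (disc-↭ p)))

  -- The minimal sums never decrease: σ f (f′ ∷ fs) ≥ σ f fs ≥ σ f′ fs, the latter by minimality of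
  -- `f′`. So one infinite sum makes all later ones infinite.
  greedy-disc≡∞ : ∀ f fs → Greedy (f ∷ fs) → disc fs ≡ nothing → σ f fs ≡ nothing
  greedy-disc≡∞ f (f′ ∷ fs) (_ , f′-min , fs-greedy) eq =
    ≡.trans (cong (d f f′ ⊕_) (∞≤⇒≡∞ σf′≡∞ (f′-min f))) (⊕-comm (d f f′) nothing)
    where
    σf′≡∞ : σ f′ fs ≡ nothing
    σf′≡∞ with ⊕≡∞ (σ f′ fs) (disc fs) eq
    ... | inj₁ p = p
    ... | inj₂ p = greedy-disc≡∞ f′ fs (f′-min , fs-greedy) p

  -- `disc (f ∷ fs)` splits both as `σ f fs ⊕ disc fs` and as `σ r rest ⊕ disc rest`. Since
  -- `disc fs` is minimal, it can be cancelled when finite, leaving `σ r rest ≤∞ σ f fs`.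
  greedy-bound : ∀ f fs → Greedy (f ∷ fs) → ∀ ys → length ys ≡ length fs →
    ∃ λ r → σ r ys ≤∞ σ f fs
  greedy-bound f fs greedy ys len with nothing ≤∞? disc fs
  -- Here the bound `σ f fs` is infinite, so any point serves as `r`.
  ... | yes ∞≤disc = f , subst (σ f ys ≤∞_)
    (sym (greedy-disc≡∞ f fs greedy (∞≤⇒≡∞ ≡.refl ∞≤disc))) (≤∞-nothing (σ f ys))
  ... | no disc<∞ with exchange ys (f ∷ fs) (cong suc (sym len))
  ... | r , rest , p , r≤ =
    r , ≤∞-trans _ (σ r rest) _ r≤
          (⊕-cancel (σ r rest) (σ f fs) (disc fs) (disc rest)
            (λ disc≡∞ → disc<∞ (≤∞-reflexive (sym disc≡∞)))
            (greedy-disc-min fs (proj₂ greedy) rest (ℕ.suc-injective (sym (↭-length p))))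
            (sym (disc-↭ p)))

-- Orders of power series

-- Expresses that the order is at least `u`, without the nonzero coefficient that `Ord` demands at a
-- finite `u`.
Vanishes : PS → ℕ∞ → Set
Vanishes f u = ∀ i → just (suc i) ≤∞ u → f i ≡ 0ℚ

ord⇒vanishes : ∀ {f} u → Ord f u → Vanishes f u
ord⇒vanishes (just n) (f≡0 , _) i i<n = f≡0 i i<n
ord⇒vanishes nothing f≡0 i _ = f≡0 i

vanishes⇒≤ : ∀ {f} u w → Vanishes f u → Ord f w → u ≤∞ w
vanishes⇒≤ u nothing _ _ = ≤∞-nothing u
vanishes⇒≤ (just m) (just n) f≡0 (_ , fn≢0) = ℕ.≮⇒≥ λ n<m → fn≢0 (f≡0 n n<m)
vanishes⇒≤ nothing (just n) f≡0 (_ , fn≢0) = fn≢0 (f≡0 n tt)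

open GroupProperties ℚ.+-0-group using (x∙y⁻¹≈ε⇒x≈y; x≈y⇒x∙y⁻¹≈ε)

ord-sym : ∀ f g u w → Ord (f −ₚ g) u → Ord (g −ₚ f) w → u ≡ w
ord-sym f g u w ord-u ord-w =
  ≤∞-antisym u w (half f g u w ord-u ord-w) (half g f w u ord-w ord-u)
  where
  half : ∀ f g u w → Ord (f −ₚ g) u → Ord (g −ₚ f) w → u ≤∞ w
  half f g u w ord-u = vanishes⇒≤ u w λ i i<u →
    x≈y⇒x∙y⁻¹≈ε (sym (x∙y⁻¹≈ε⇒x≈y (f i) (g i) (ord⇒vanishes u ord-u i i<u)))

ord-ultra : ∀ f g h u v w → Ord (f −ₚ g) u → Ord (h −ₚ g) v → Ord (f −ₚ h) w →
  u ≤∞ v → u ≤∞ w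
ord-ultra f g h u v w ord-u ord-v ord-w u≤v = vanishes⇒≤ u w vanish ord-w
  where
  vanish : Vanishes (f −ₚ h) u
  vanish i i<u = x≈y⇒x∙y⁻¹≈ε (≡.trans
    (x∙y⁻¹≈ε⇒x≈y (f i) (g i) (ord⇒vanishes u ord-u i i<u))
    (sym (x∙y⁻¹≈ε⇒x≈y (h i) (g i)
      (ord⇒vanishes v ord-v i (≤∞-trans _ u v i<u u≤v)))))

-- If no order existed, a first nonzero coefficient would supply one; so by strong induction all
-- coefficients vanish, and the order is infinite after all.
¬¬ord : ∀ f → ¬ ¬ ∃ (Ord f)
¬¬ord f no-ord = no-ord (nothing , f≡0)
  where
  f≡0 : ∀ i → f i ≡ 0ℚ
  f≡0 = <-rec _ λ i below → decidable-stable (f i ℚ.≟ 0ℚ) λ fi≢0 →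
    no-ord (just i , (λ j j<i → below j<i) , fi≢0)

¬¬-Fin : ∀ {n} {P : Fin n → Set} → (∀ i → ¬ ¬ P i) → ¬ ¬ (∀ i → P i)
¬¬-Fin = sequence (RawMonad.rawApplicative ¬¬-Monad)

-- Unlike in IsTOrdering, k may be 0.
tOrdering-min : ∀ {U f} → IsTOrdering U f → ∀ k g → U g → ∀ {a b} →
  SumOrd (f k) f k a → SumOrd g f k b → a ≤∞ b
tOrdering-min _ zero g _ (_ , _ , ≡.refl) (_ , _ , ≡.refl) = z≤n
tOrdering-min (_ , min) (suc k) g g∈U = min (suc k) (s≤s z≤n) g g∈U _ _

-- Constructively, orders exist only up to double negation, so d is tabulated on a
-- finite set of points only: the first M terms of each of the three sequences.
module Prefixes (F : Fin 3 → ℕ → PS) (M : ℕ) where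

  X : Set
  X = Fin 3 × Fin M

  P : X → PS
  P (c , i) = F c (toℕ i)

  ¬¬orders : ¬ ¬ (Σ (X → X → ℕ∞) λ d → ∀ x y → Ord (P x −ₚ P y) (d x y))
  ¬¬orders = ¬¬-map
    (λ o → (λ (c , i) (c′ , i′) → proj₁ (o c i c′ i′)) ,
           (λ (c , i) (c′ , i′) → proj₂ (o c i c′ i′)))
    (¬¬-Fin λ c → ¬¬-Fin λ i → ¬¬-Fin λ c′ → ¬¬-Fin λ i′ →
      ¬¬ord (P (c , i) −ₚ P (c′ , i′)))

  point : Fin 3 → ∀ i → i < M → X
  point c i i<M = c , fromℕ< i<M

  P-point : ∀ c i (i<M : i < M) → P (point c i i<M) ≡ F c i
  P-point c i i<M = cong (F c) (toℕ-fromℕ< i<M)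

  point-cong : ∀ c {i j} (i<M : i < M) (j<M : j < M) → i ≡ j →
    point c i i<M ≡ point c j j<M
  point-cong c i<M j<M i≡j = cong (c ,_) (fromℕ<-cong _ _ i≡j i<M j<M)

  prefix : Fin 3 → ∀ m → m ≤ M → List X
  prefix c zero _ = []
  prefix c (suc m) m<M = point c m m<M ∷ prefix c m (ℕ.<⇒≤ m<M)

  length-prefix : ∀ c m m≤M → length (prefix c m m≤M) ≡ m
  length-prefix c zero _ = ≡.refl
  length-prefix c (suc m) m<M = cong suc (length-prefix c m (ℕ.<⇒≤ m<M))

  module _ (d : X → X → ℕ∞) (d-ord : ∀ x y → Ord (P x −ₚ P y) (d x y)) where

    open Ultrametric d
      (λ x y → ord-sym (P x) (P y) _ _ (d-ord x y) (d-ord y x))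
      (λ x y z → ord-ultra (P x) (P y) (P z) _ _ _ (d-ord x y) (d-ord z y) (d-ord x z))

    sumOrd-prefix : ∀ x c m m≤M → SumOrd (P x) (F c) m (σ x (prefix c m m≤M))
    sumOrd-prefix x c m m≤M =
      (λ j → d x (pt m m≤M j)) ,
      (λ j → subst (λ f → Ord (P x −ₚ f) (d x (pt m m≤M j))) (P-point c (toℕ j) (ℕ.<-≤-trans (toℕ<n j) m≤M))
               (d-ord x (pt m m≤M j))) ,
      sum-prefix m m≤M
      where
      pt : ∀ m → m ≤ M → Fin m → X
      pt m m≤M j = point c (toℕ j) (ℕ.<-≤-trans (toℕ<n j) m≤M)

      sum-prefix : ∀ m m≤M → sum∞ m (λ j → d x (pt m m≤M j)) ≡ σ x (prefix c m m≤M)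
      sum-prefix zero _ = ≡.refl
      sum-prefix (suc m) m<M = ≡.trans (sum∞-last m (λ j → d x (pt (suc m) m<M j)))
        (cong₂ _⊕_
          (cong (d x) (point-cong c (ℕ.<-≤-trans (toℕ<n (fromℕ m)) m<M) m<M (toℕ-fromℕ m)))
          (≡.trans
            (sum∞-cong m λ j → cong (d x)
              (point-cong c (ℕ.<-≤-trans (toℕ<n (inject₁ j)) m<M)
                (ℕ.<-≤-trans (toℕ<n j) (ℕ.<⇒≤ m<M)) (toℕ-inject₁ j)))
            (sum-prefix m (ℕ.<⇒≤ m<M))))

    module _ {U : Subset} (F-ord : ∀ c → IsTOrdering U (F c)) where

      P∈U : ∀ x → U (P x)
      P∈U (c , i) = proj₁ (F-ord c) (toℕ i)

      -- Minimality over `U` restricts to the tabulated points, all of which lie in `U`.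
      sumOrd≤σ : ∀ c m m≤M {a} → SumOrd (F c m) (F c) m a →
        ∀ x → a ≤∞ σ x (prefix c m m≤M)
      sumOrd≤σ c m m≤M s x =
        tOrdering-min (F-ord c) m (P x) (P∈U x) s (sumOrd-prefix x c m m≤M)

      sumOrd-point : ∀ c m m<M →
        SumOrd (F c m) (F c) m (σ (point c m m<M) (prefix c m (ℕ.<⇒≤ m<M)))
      sumOrd-point c m m<M =
        subst (λ f → SumOrd f (F c) m (σ (point c m m<M) (prefix c m (ℕ.<⇒≤ m<M))))
          (P-point c m m<M) (sumOrd-prefix (point c m m<M) c m (ℕ.<⇒≤ m<M))

      prefix-greedy : ∀ c m m≤M → Greedy (prefix c m m≤M)
      prefix-greedy c zero _ = tt
      prefix-greedy c (suc m) m<M =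
        sumOrd≤σ c m (ℕ.<⇒≤ m<M) (sumOrd-point c m m<M) ,
        prefix-greedy c m (ℕ.<⇒≤ m<M)

      -- Three indices occur because the three exponents may come from different t-orderings.
      superadditive : ∀ c₀ c₁ c₂ k ℓ → k + ℓ < M → ∀ {a b c} →
        SumOrd (F c₀ (k + ℓ)) (F c₀) (k + ℓ) a →
        SumOrd (F c₁ k) (F c₁) k b → SumOrd (F c₂ ℓ) (F c₂) ℓ c → (b ⊕ c) ≤∞ a
      superadditive c₀ c₁ c₂ k ℓ n<M {a} {b} {c} sum-a sum-b sum-c =
        ≤∞-trans _ (σ r ys ⊕ σ r zs) _
          (⊕-mono b (σ r ys) c (σ r zs)
            (sumOrd≤σ c₁ k k≤M sum-b r) (sumOrd≤σ c₂ ℓ ℓ≤M sum-c r))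
          (≤∞-trans _ (σ top (prefix c₀ (k + ℓ) n≤M)) a
            (subst (_≤∞ σ top (prefix c₀ (k + ℓ) n≤M)) (σ-++ r ys zs) (proj₂ bound))
            -- The tabulated sum and `a` belong to the same point; comparing that point with itself
            -- by minimality bounds one by the other.
            (tOrdering-min (F-ord c₀) (k + ℓ) _ (proj₁ (F-ord c₀) (k + ℓ))
              (sumOrd-point c₀ (k + ℓ) n<M) sum-a))
        where
        n≤M = ℕ.<⇒≤ n<M
        k≤M = ℕ.≤-trans (ℕ.m≤m+n k ℓ) n≤M
        ℓ≤M = ℕ.≤-trans (ℕ.m≤n+m ℓ k) n≤M
        ys = prefix c₁ k k≤M
        zs = prefix c₂ ℓ ℓ≤M
        top = point c₀ (k + ℓ) n<M
        len : length (ys ++ zs) ≡ length (prefix c₀ (k + ℓ) n≤M)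
        len = ≡.trans (length-++ ys)
          (≡.trans (cong₂ _+_ (length-prefix c₁ k k≤M) (length-prefix c₂ ℓ ℓ≤M))
                   (sym (length-prefix c₀ (k + ℓ) n≤M)))
        bound = greedy-bound top (prefix c₀ (k + ℓ) n≤M)
          (prefix-greedy c₀ (suc (k + ℓ)) n<M) (ys ++ zs) len
        r = proj₁ bound

theorem4p8 : (U : Subset) → Nonempty U →
    (k ℓ : ℕ) (a b c : ℕ∞) →
    IsAlpha U (k + ℓ) a → IsAlpha U k b → IsAlpha U ℓ c →
    (b ⊕ c) ≤∞ a
theorem4p8 U _ k ℓ a b c (f , f-ord , sum-a) (g , g-ord , sum-b) (h , h-ord , sum-c) =
  -- The goal is decidable, so a table of orders existing only up to double negation suffices.
  decidable-stable ((b ⊕ c) ≤∞? a) (¬¬-map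
    (λ (d , d-ord) → superadditive d d-ord F-ord zero (suc zero) (suc (suc zero)) k ℓ
      ℕ.≤-refl sum-a sum-b sum-c)
    ¬¬orders)
  where
  F : Fin 3 → ℕ → PS
  F zero = f
  F (suc zero) = g
  F (suc (suc zero)) = h

  F-ord : ∀ i → IsTOrdering U (F i)
  F-ord zero = f-ord
  F-ord (suc zero) = g-ord
  F-ord (suc (suc zero)) = h-ord

  -- The table must include the term of index `k + ℓ` itself.
  open Prefixes F (suc (k + ℓ))
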